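{- For a presentation of a pre-d-frame as in the context, condition ($\lambda^1_+$) holds iff ($\lambda^0_+$) holds, and ($\lambda^1_-$) holds iff ($\lambda^0_-$) holds, where: ($\lambda^0_+$): $\alpha\in\mathcal D(\downarrow\mathsf{con}_{\wedge,\vee})$, $\beta\in\uparrow\mathsf{tot}_{\wedge,\vee}$, $\alpha_+=\beta_+$ imply $\alpha_-\le\beta_-$; ($\lambda^0_-$): $\alpha\in\mathcal D(\downarrow\mathsf{con}_{\wedge,\vee})$, $\beta\in\uparrow\mathsf{tot}_{\wedge,\vee}$, $\alpha_-=\beta_-$ imply $\alpha_+\le\beta_+$; ($\lambda^1_+$): $\alpha\in\mathcal D(\downarrow\mathsf{con}_{\wedge,\vee})$, $\beta\in\mathsf{tot}_{\wedge,\vee}$, $\beta_+\le\alpha_+$ imply $\alpha_-\le\beta_-$; ($\lambda^1_-$): $\alpha\in\mathcal D(\downarrow\mathsf{con}_{\wedge,\vee})$, $\beta\in\mathsf{tot}_{\wedge,\vee}$, $\beta_-\le\alpha_-$ imply $\alpha_+\le\beta_+$.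
   Context: Let $(B_\pm,\mathcal C_\pm)$ be frame presentations ($B$ a meet-semilattice with top, $\mathcal C$ a set of pairs $U\dashv a$ with $a\in B$, $U\subseteq\downarrow a$, stable: $U\dashv a\in\mathcal C$, $b\le a\Rightarrow\{u\wedge b:u\in U\}\dashv b\in\mathcal C$), $L_\pm$ the frame of $\mathcal C_\pm$-ideals (downsets $I$ with $U\dashv a\in\mathcal C,U\subseteq I\Rightarrow a\in I$, ordered by inclusion), $b\in B_\pm$ identified with the smallest $\mathcal C_\pm$-ideal containing it, and $\mathsf{con}_1,\mathsf{tot}_1\subseteq B_+\times B_-\subseteq L_+\times L_-$. On $L_+\times L_-$: $\alpha\sqsubseteq\beta$ iff $\alpha_+\le\beta_+,\alpha_-\le\beta_-$; logical join $(\alpha_+\vee\beta_+,\alpha_-\wedge\beta_-)$, logical meet $(\alpha_+\wedge\beta_+,\alpha_-\vee\beta_-)$. $\mathsf{con}_{\wedge,\vee}$, $\mathsf{tot}_{\wedge,\vee}$ are the closures of $\mathsf{con}_1$, $\mathsf{tot}_1$ under all finite logical meets and joins. $\downarrow,\uparrow$ denote $\sqsubseteq$-downward/upward closure. $\mathcal D(R)=\{(\bigvee_{\alpha\in A}\alpha_+,\bigvee_{\alpha\in A}\alpha_-): A\subseteq R\ \sqsubseteq\text{ -directed}\}$. -}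

module Defs where

open import Level using (0ℓ) renaming (suc to lsuc)
open import Data.Product using (Σ; _×_; _,_; ∃; proj₁; proj₂)
open import Data.Sum using (_⊎_)
open import Function.Bundles using (_⇔_)
open import Relation.Binary.Lattice.Bundles using (BoundedMeetSemilattice)

-- Frame presentations (B , 𝒞).
-- 𝒞 is a set of pairs U ⊣ a, given as a family indexed by a type Cov:
-- the i-th pair is (cov i , tgt i), with cov i a subset of B.

record FramePresentation : Set₁ where
  field
    B    : BoundedMeetSemilattice 0ℓ 0ℓ 0ℓ
  open BoundedMeetSemilattice B public
  field
    Cov  : Set
    cov  : Cov → Carrier → Set
    tgt  : Cov → Carrier
    cov-below : ∀ i x → cov i x → x ≤ tgt i
    stable : ∀ i b → b ≤ tgt i →
      Σ Cov λ j → (tgt j ≈ b) ×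
        (∀ x → cov j x ⇔ (Σ Carrier λ u → cov i u × (x ≈ (u ∧ b))))

module _ (P : FramePresentation) where
  open FramePresentation P

  record Ideal : Set₁ where
    field
      mem    : Carrier → Set
      down   : ∀ {x y} → y ≤ x → mem x → mem y
      closed : ∀ i → (∀ u → cov i u → mem u) → mem (tgt i)
  open Ideal public

  data Gen (S : Carrier → Set) : Carrier → Set where
    gen-inc   : ∀ {x} → S x → Gen S x
    gen-down  : ∀ {x y} → y ≤ x → Gen S x → Gen S y
    gen-cover : ∀ i → (∀ u → cov i u → Gen S u) → Gen S (tgt i)

  genIdeal : (Carrier → Set) → Ideal
  genIdeal S = record { mem = Gen S ; down = gen-down ; closed = gen-cover }

  ι : Carrier → Ideal
  ι b = genIdeal (λ x → x ≈ b)

  _⊆ᴵ_ : Ideal → Ideal → Set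
  I ⊆ᴵ J = ∀ x → mem I x → mem J x

  _≐ᴵ_ : Ideal → Ideal → Set
  I ≐ᴵ J = (I ⊆ᴵ J) × (J ⊆ᴵ I)

  _∧ᴵ_ : Ideal → Ideal → Ideal
  I ∧ᴵ J = record
    { mem    = λ x → mem I x × mem J x
    ; down   = λ y≤x p → down I y≤x (proj₁ p) , down J y≤x (proj₂ p)
    ; closed = λ i h → closed I i (λ u c → proj₁ (h u c))
                     , closed J i (λ u c → proj₂ (h u c))
    }

  _∨ᴵ_ : Ideal → Ideal → Ideal
  I ∨ᴵ J = genIdeal (λ x → mem I x ⊎ mem J x)

  ⋁ᴵ : {K : Set} → (K → Ideal) → Ideal
  ⋁ᴵ {K} f = genIdeal (λ x → Σ K λ k → mem (f k) x)

record PreDFramePresentation : Set₁ where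
  field
    P₊ P₋ : FramePresentation
  module B₊ = FramePresentation P₊
  module B₋ = FramePresentation P₋
  field
    con₁ : B₊.Carrier → B₋.Carrier → Set
    tot₁ : B₊.Carrier → B₋.Carrier → Set

module PDF (D : PreDFramePresentation) where
  open PreDFramePresentation D

  L₊ L₋ : Set₁
  L₊ = Ideal P₊
  L₋ = Ideal P₋

  Pair : Set₁
  Pair = L₊ × L₋

  _⁺ : Pair → L₊
  α ⁺ = proj₁ α
  _⁻ : Pair → L₋
  α ⁻ = proj₂ α

  _≤₊_ _≐₊_ : L₊ → L₊ → Set
  _≤₊_ = _⊆ᴵ_ P₊
  _≐₊_ = _≐ᴵ_ P₊
  _≤₋_ _≐₋_ : L₋ → L₋ → Set
  _≤₋_ = _⊆ᴵ_ P₋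
  _≐₋_ = _≐ᴵ_ P₋

  _⊑_ : Pair → Pair → Set
  α ⊑ β = ((α ⁺) ≤₊ (β ⁺)) × ((α ⁻) ≤₋ (β ⁻))

  _⩔_ : Pair → Pair → Pair
  α ⩔ β = _∨ᴵ_ P₊ (α ⁺) (β ⁺) , _∧ᴵ_ P₋ (α ⁻) (β ⁻)

  _⩓_ : Pair → Pair → Pair
  α ⩓ β = _∧ᴵ_ P₊ (α ⁺) (β ⁺) , _∨ᴵ_ P₋ (α ⁻) (β ⁻)

  embed : B₊.Carrier → B₋.Carrier → Pair
  embed a b = ι P₊ a , ι P₋ b

  data Closure∧∨ (R₁ : B₊.Carrier → B₋.Carrier → Set) : Pair → Set₁ where
    base : ∀ {a b} → R₁ a b → Closure∧∨ R₁ (embed a b)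
    join : ∀ {α β} → Closure∧∨ R₁ α → Closure∧∨ R₁ β → Closure∧∨ R₁ (α ⩔ β)
    meet : ∀ {α β} → Closure∧∨ R₁ α → Closure∧∨ R₁ β → Closure∧∨ R₁ (α ⩓ β)

  con∧∨ tot∧∨ : Pair → Set₁
  con∧∨ = Closure∧∨ con₁
  tot∧∨ = Closure∧∨ tot₁

  ↓_ ↑_ : (Pair → Set₁) → Pair → Set₁
  (↓ R) α = Σ Pair λ γ → R γ × (α ⊑ γ)
  (↑ R) α = Σ Pair λ γ → R γ × (γ ⊑ α)

  record DirectedIn (R : Pair → Set₁) (K : Set) (A : K → Pair) : Set₁ where
    field
      inR      : ∀ k → R (A k)
      inhabited : K
      directed : ∀ k l → Σ K λ m → (A k ⊑ A m) × (A l ⊑ A m)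

  𝒟 : (Pair → Set₁) → Pair → Set₁
  𝒟 R α = Σ Set λ K → Σ (K → Pair) λ A → DirectedIn R K A ×
            ((α ⁺) ≐₊ ⋁ᴵ P₊ (λ k → A k ⁺)) × ((α ⁻) ≐₋ ⋁ᴵ P₋ (λ k → A k ⁻))

  λ⁰₊ λ⁰₋ λ¹₊ λ¹₋ : Set₁
  λ⁰₊ = ∀ α β → 𝒟 (↓ con∧∨) α → (↑ tot∧∨) β → (α ⁺) ≐₊ (β ⁺) → (α ⁻) ≤₋ (β ⁻)
  λ⁰₋ = ∀ α β → 𝒟 (↓ con∧∨) α → (↑ tot∧∨) β → (α ⁻) ≐₋ (β ⁻) → (α ⁺) ≤₊ (β ⁺)
  λ¹₊ = ∀ α β → 𝒟 (↓ con∧∨) α → tot∧∨ β → (β ⁺) ≤₊ (α ⁺) → (α ⁻) ≤₋ (β ⁻)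
  λ¹₋ = ∀ α β → 𝒟 (↓ con∧∨) α → tot∧∨ β → (β ⁻) ≤₋ (α ⁻) → (α ⁺) ≤₊ (β ⁺)

-- A total β with β⁺ ≤ α⁺ can be replaced by (α⁺ , β⁻), which lies ⊑-above β
-- (hence in ↑tot) and has the same ⁺-part as α; conversely, a witness γ ⊑ β of
-- β ∈ ↑tot satisfies γ⁺ ≤ β⁺ = α⁺ and γ⁻ ≤ β⁻. Nothing about 𝒟(↓con) or tot
-- is used, so the equivalences hold for arbitrary predicates in their place.
module Submission where

open import Defs
open import Data.Product using (_×_; _,_)
open import Function.Bundles using (_⇔_; mk⇔)

module _ (P : FramePresentation) where

  ⊆ᴵ-refl : ∀ I → _⊆ᴵ_ P I I
  ⊆ᴵ-refl _ _ x∈I = x∈I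

  ⊆ᴵ-trans : ∀ I J K → _⊆ᴵ_ P I J → _⊆ᴵ_ P J K → _⊆ᴵ_ P I K
  ⊆ᴵ-trans _ _ _ I⊆J J⊆K x x∈I = J⊆K x (I⊆J x x∈I)

module _ (D : PreDFramePresentation) where
  open PreDFramePresentation D using (P₊; P₋)
  open PDF D

  Λ¹₊ Λ⁰₊ Λ¹₋ Λ⁰₋ : (Pair → Set₁) → (Pair → Set₁) → Set₁
  Λ¹₊ A T = ∀ α β → A α → T β → (β ⁺) ≤₊ (α ⁺) → (α ⁻) ≤₋ (β ⁻)
  Λ⁰₊ A T = ∀ α β → A α → (↑ T) β → (α ⁺) ≐₊ (β ⁺) → (α ⁻) ≤₋ (β ⁻)
  Λ¹₋ A T = ∀ α β → A α → T β → (β ⁻) ≤₋ (α ⁻) → (α ⁺) ≤₊ (β ⁺)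
  Λ⁰₋ A T = ∀ α β → A α → (↑ T) β → (α ⁻) ≐₋ (β ⁻) → (α ⁺) ≤₊ (β ⁺)

  Λ¹₊⇒Λ⁰₊ : ∀ {A T} → Λ¹₊ A T → Λ⁰₊ A T
  Λ¹₊⇒Λ⁰₊ h α β α∈A (γ , γ∈T , γ⁺≤β⁺ , γ⁻≤β⁻) (_ , β⁺≤α⁺) =
    ⊆ᴵ-trans P₋ (α ⁻) (γ ⁻) (β ⁻)
      (h α γ α∈A γ∈T (⊆ᴵ-trans P₊ (γ ⁺) (β ⁺) (α ⁺) γ⁺≤β⁺ β⁺≤α⁺)) γ⁻≤β⁻

  Λ⁰₊⇒Λ¹₊ : ∀ {A T} → Λ⁰₊ A T → Λ¹₊ A T
  Λ⁰₊⇒Λ¹₊ h α β α∈A β∈T β⁺≤α⁺ =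
    h α (α ⁺ , β ⁻) α∈A (β , β∈T , β⁺≤α⁺ , ⊆ᴵ-refl P₋ (β ⁻)) (⊆ᴵ-refl P₊ (α ⁺) , ⊆ᴵ-refl P₊ (α ⁺))

  Λ¹₋⇒Λ⁰₋ : ∀ {A T} → Λ¹₋ A T → Λ⁰₋ A T
  Λ¹₋⇒Λ⁰₋ h α β α∈A (γ , γ∈T , γ⁺≤β⁺ , γ⁻≤β⁻) (_ , β⁻≤α⁻) =
    ⊆ᴵ-trans P₊ (α ⁺) (γ ⁺) (β ⁺)
      (h α γ α∈A γ∈T (⊆ᴵ-trans P₋ (γ ⁻) (β ⁻) (α ⁻) γ⁻≤β⁻ β⁻≤α⁻)) γ⁺≤β⁺

  Λ⁰₋⇒Λ¹₋ : ∀ {A T} → Λ⁰₋ A T → Λ¹₋ A T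
  Λ⁰₋⇒Λ¹₋ h α β α∈A β∈T β⁻≤α⁻ =
    h α (β ⁺ , α ⁻) α∈A (β , β∈T , ⊆ᴵ-refl P₊ (β ⁺) , β⁻≤α⁻) (⊆ᴵ-refl P₋ (α ⁻) , ⊆ᴵ-refl P₋ (α ⁻))

lemma11 : (D : PreDFramePresentation) →
    (PDF.λ¹₊ D ⇔ PDF.λ⁰₊ D) × (PDF.λ¹₋ D ⇔ PDF.λ⁰₋ D)
lemma11 D = mk⇔ (Λ¹₊⇒Λ⁰₊ D) (Λ⁰₊⇒Λ¹₊ D) , mk⇔ (Λ¹₋⇒Λ⁰₋ D) (Λ⁰₋⇒Λ¹₋ D)
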